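{- Let $L:\mathscr A\to\mathscr B$ and $R:\mathscr B\to\mathscr A$ be functors between categories with $L\dashv R$, and let $F:\mathscr C\to\mathscr A$, $G:\mathscr B\to\mathscr C$ be functors forming an $R$-relative coadjunction, i.e. equipped with bijections $\Psi_{C,B}:\mathscr A(FC,RB)\cong\mathscr C(C,GB)$ natural in $C\in\mathscr C$ and $B\in\mathscr B$. Then this data induces a positive adjunction between $\mathscr C$ and the duploid $\mathbf{dupl}_{L,R}$, with left adjoint $F:\mathscr C\to\mathbf{dupl}_{L,R}$ and right adjoint the bare functor $G^-:\mathbf{dupl}_{L,R}\rightharpoonup\mathscr C$.
   Context: A non-associative category is a category without the associativity axiom (identities are still neutral). A bare functor $\mathscr D\rightharpoonup\mathscr E$ between non-associative categories is a morphism of reflexive graphs (preserves sources, targets and identities, not necessarily composition). A morphism $f$ is thunkable if $(h\circ g)\circ f=h\circ(g\circ f)$ for all composable $g,h$; $h$ is linear if $(h\circ g)\circ f=h\circ(g\circ f)$ for all composable $f,g$. An object $A$ is positive if every morphism with source $A$ is linear; negative if every morphism with target $A$ is thunkable. An adjunction over non-associative categories $\mathscr D,\mathscr E$ consists of bare functors $F:\mathscr D\rightharpoonup\mathscr E$, $G:\mathscr E\rightharpoonup\mathscr D$ and bijections $\varphi_{A,B}:\mathscr E(FA,B)\cong\mathscr D(A,GB)$ natural separately in each variable: $\varphi(g\circ h)=Gg\circ\varphi(h)$ and $\varphi(h\circ Ff)=\varphi(h)\circ f$ for all composable $g,h,f$. It is positive when $FA$ is a positive object for every $A$. The non-associative category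 $\mathbf{dupl}_{L,R}$: its objects are $|\mathscr A|\uplus|\mathscr B|$. For an object $X$ set $X^+=X$ if $X\in\mathscr A$, $X^+=RX$ if $X\in\mathscr B$; $X^-=LX$ if $X\in\mathscr A$, $X^-=X$ if $X\in\mathscr B$. Put $\mathbf{dupl}_{L,R}(X,Y)=\mathscr A(X^+,RY^-)$ (equivalently $\mathscr B(LX^+,Y^-)$). The identity on $X$ is the unit $\eta_X:X\to RLX$ if $X\in\mathscr A$ and $\mathrm{id}_{RX}$ if $X\in\mathscr B$. For $f\in\mathscr A(X^+,RZ^-)$ and $g\in\mathscr A(Z^+,RY^-)$, the composite is $R(\hat g)\circ f$ if $Z\in\mathscr A$, where $\hat g:LZ\to Y^-$ is the transpose of $g$, and is $g\circ f$ (composition in $\mathscr A$) if $Z\in\mathscr B$. The left adjoint $F:\mathscr C\to\mathbf{dupl}_{L,R}$ sends $C$ to $FC\in|\mathscr A|$ and $f:C\to C'$ to $\eta_{FC'}\circ Ff\in\mathscr A(FC,RLFC')$. The bare functor $G^-$: on objects $G^-X=G(X^-)$. On $f\in\mathbf{dupl}_{L,R}(X,Y)=\mathscr A(X^+,RY^-)$: if $X\in\mathscr A$, $G^-f=G(\hat f)$ with $\hat f:LX\to Y^-$ the transpose of $f$; if $X\in\mathscr B$, $G^-f=\Psi_{GX,Y^- }(f\circ\varepsilon_X)$, where $\varepsilon_X=\Psi_{GX,X}^{ -1}(\mathrm{id}_{GX}):FGX\to RX$. -}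

module Defs where

open import Level using (Level; suc; _⊔_)
open import Data.Sum using (_⊎_; inj₁; inj₂)
open import Function.Bundles using (Inverse)
open import Relation.Binary.Bundles using (Setoid)
open import Relation.Binary.Core using (Rel)
open import Relation.Binary.Structures using (IsEquivalence)
import Relation.Binary.Reasoning.Setoid as SetoidReasoning

-- Morphisms between two objects form a setoid; equality of morphisms always
-- means _≈_, and all operations on morphisms respect it.
record NonAssociativeCategory (o ℓ e : Level) : Set (suc (o ⊔ ℓ ⊔ e)) where
  infixr 9 _∘_
  infix  4 _≈_ _⇒_
  field
    Obj       : Set o
    _⇒_       : Rel Obj ℓ
    _≈_       : ∀ {A B} → Rel (A ⇒ B) e
    equiv     : ∀ {A B} → IsEquivalence (_≈_ {A} {B})
    id        : ∀ {A} → A ⇒ A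
    _∘_       : ∀ {A B C} → B ⇒ C → A ⇒ B → A ⇒ C
    ∘-cong    : ∀ {A B C} {g g′ : B ⇒ C} {f f′ : A ⇒ B} →
                g ≈ g′ → f ≈ f′ → g ∘ f ≈ g′ ∘ f′
    identityˡ : ∀ {A B} {f : A ⇒ B} → id ∘ f ≈ f
    identityʳ : ∀ {A B} {f : A ⇒ B} → f ∘ id ≈ f

  hom : Obj → Obj → Setoid ℓ e
  hom A B = record { Carrier = A ⇒ B ; _≈_ = _≈_ ; isEquivalence = equiv }

  module Equiv {A B : Obj} = IsEquivalence (equiv {A} {B})

  Linear : ∀ {A B} → A ⇒ B → Set (o ⊔ ℓ ⊔ e)
  Linear {A} h = ∀ {X Y} (f : X ⇒ Y) (g : Y ⇒ A) → (h ∘ g) ∘ f ≈ h ∘ (g ∘ f)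

  Positive : Obj → Set (o ⊔ ℓ ⊔ e)
  Positive A = ∀ {B} (h : A ⇒ B) → Linear h

record Category (o ℓ e : Level) : Set (suc (o ⊔ ℓ ⊔ e)) where
  field
    nonAssociativeCategory : NonAssociativeCategory o ℓ e
  open NonAssociativeCategory nonAssociativeCategory public
  field
    assoc : ∀ {A B C D} {h : C ⇒ D} {g : B ⇒ C} {f : A ⇒ B} →
            (h ∘ g) ∘ f ≈ h ∘ (g ∘ f)

⌊_⌋ : ∀ {o ℓ e} → Category o ℓ e → NonAssociativeCategory o ℓ e
⌊ 𝒞 ⌋ = Category.nonAssociativeCategory 𝒞

record BareFunctor {o ℓ e o′ ℓ′ e′ : Level}
                   (𝒟 : NonAssociativeCategory o ℓ e)
                   (ℰ : NonAssociativeCategory o′ ℓ′ e′) :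
                   Set (o ⊔ ℓ ⊔ e ⊔ o′ ⊔ ℓ′ ⊔ e′) where
  private
    module 𝒟 = NonAssociativeCategory 𝒟
    module ℰ = NonAssociativeCategory ℰ
  field
    F₀       : 𝒟.Obj → ℰ.Obj
    F₁       : ∀ {A B} → A 𝒟.⇒ B → F₀ A ℰ.⇒ F₀ B
    F-cong   : ∀ {A B} {f g : A 𝒟.⇒ B} → f 𝒟.≈ g → F₁ f ℰ.≈ F₁ g
    identity : ∀ {A} → F₁ (𝒟.id {A}) ℰ.≈ ℰ.id

record Functor {o ℓ e o′ ℓ′ e′ : Level}
               (𝒟 : NonAssociativeCategory o ℓ e)
               (ℰ : NonAssociativeCategory o′ ℓ′ e′) :
               Set (o ⊔ ℓ ⊔ e ⊔ o′ ⊔ ℓ′ ⊔ e′) where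
  private
    module 𝒟 = NonAssociativeCategory 𝒟
    module ℰ = NonAssociativeCategory ℰ
  field
    bareFunctor : BareFunctor 𝒟 ℰ
  open BareFunctor bareFunctor public
  field
    homomorphism : ∀ {A B C} {g : B 𝒟.⇒ C} {f : A 𝒟.⇒ B} →
                   F₁ (g 𝒟.∘ f) ℰ.≈ F₁ g ℰ.∘ F₁ f

record Adjunction {o ℓ e o′ ℓ′ e′ : Level}
                  {𝒟 : NonAssociativeCategory o ℓ e}
                  {ℰ : NonAssociativeCategory o′ ℓ′ e′}
                  (F : BareFunctor 𝒟 ℰ) (G : BareFunctor ℰ 𝒟) :
                  Set (o ⊔ ℓ ⊔ e ⊔ o′ ⊔ ℓ′ ⊔ e′) where
  private
    module 𝒟 = NonAssociativeCategory 𝒟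
    module ℰ = NonAssociativeCategory ℰ
    module F = BareFunctor F
    module G = BareFunctor G
  field
    bijection : ∀ A B → Inverse (ℰ.hom (F.F₀ A) B) (𝒟.hom A (G.F₀ B))

  φ : ∀ {A B} → F.F₀ A ℰ.⇒ B → A 𝒟.⇒ G.F₀ B
  φ {A} {B} = Inverse.to (bijection A B)

  φ⁻¹ : ∀ {A B} → A 𝒟.⇒ G.F₀ B → F.F₀ A ℰ.⇒ B
  φ⁻¹ {A} {B} = Inverse.from (bijection A B)

  field
    naturalʳ : ∀ {A B B′} (g : B ℰ.⇒ B′) (h : F.F₀ A ℰ.⇒ B) →
               φ (g ℰ.∘ h) 𝒟.≈ G.F₁ g 𝒟.∘ φ h
    naturalˡ : ∀ {A A′ B} (h : F.F₀ A ℰ.⇒ B) (f : A′ 𝒟.⇒ A) →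
               φ (h ℰ.∘ F.F₁ f) 𝒟.≈ φ h 𝒟.∘ f

  unit : ∀ A → A 𝒟.⇒ G.F₀ (F.F₀ A)
  unit A = φ (ℰ.id {F.F₀ A})

record PositiveAdjunction {o ℓ e o′ ℓ′ e′ : Level}
                          {𝒟 : NonAssociativeCategory o ℓ e}
                          {ℰ : NonAssociativeCategory o′ ℓ′ e′}
                          (F : BareFunctor 𝒟 ℰ) (G : BareFunctor ℰ 𝒟) :
                          Set (o ⊔ ℓ ⊔ e ⊔ o′ ⊔ ℓ′ ⊔ e′) where
  field
    adjunction : Adjunction F G
    positive   : ∀ A → NonAssociativeCategory.Positive ℰ (BareFunctor.F₀ F A)

-- When 𝒟 and ℰ are associative, this is the usual hom-set adjunction.
infix 4 _⊣_
_⊣_ : ∀ {o ℓ e o′ ℓ′ e′}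
      {𝒟 : NonAssociativeCategory o ℓ e} {ℰ : NonAssociativeCategory o′ ℓ′ e′} →
      Functor 𝒟 ℰ → Functor ℰ 𝒟 → Set (o ⊔ ℓ ⊔ e ⊔ o′ ⊔ ℓ′ ⊔ e′)
L ⊣ R = Adjunction (Functor.bareFunctor L) (Functor.bareFunctor R)

record RelativeCoadjunction {oa ℓa ea ob ℓb eb oc ℓc ec : Level}
                            (𝒜 : Category oa ℓa ea)
                            (ℬ : Category ob ℓb eb)
                            (𝒞 : Category oc ℓc ec)
                            (R : Functor ⌊ ℬ ⌋ ⌊ 𝒜 ⌋)
                            (F : Functor ⌊ 𝒞 ⌋ ⌊ 𝒜 ⌋)
                            (G : Functor ⌊ ℬ ⌋ ⌊ 𝒞 ⌋) :
                            Set (oa ⊔ ℓa ⊔ ea ⊔ ob ⊔ ℓb ⊔ eb ⊔ oc ⊔ ℓc ⊔ ec) where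
  private
    module 𝒜 = Category 𝒜
    module ℬ = Category ℬ
    module 𝒞 = Category 𝒞
    module R = Functor R
    module F = Functor F
    module G = Functor G
  field
    bijection : ∀ C B → Inverse (𝒜.hom (F.F₀ C) (R.F₀ B)) (𝒞.hom C (G.F₀ B))

  Ψ : ∀ {C B} → F.F₀ C 𝒜.⇒ R.F₀ B → C 𝒞.⇒ G.F₀ B
  Ψ {C} {B} = Inverse.to (bijection C B)

  Ψ⁻¹ : ∀ {C B} → C 𝒞.⇒ G.F₀ B → F.F₀ C 𝒜.⇒ R.F₀ B
  Ψ⁻¹ {C} {B} = Inverse.from (bijection C B)

  field
    naturalʳ : ∀ {C B B′} (g : B ℬ.⇒ B′) (h : F.F₀ C 𝒜.⇒ R.F₀ B) →
               Ψ (R.F₁ g 𝒜.∘ h) 𝒞.≈ G.F₁ g 𝒞.∘ Ψ h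
    naturalˡ : ∀ {C C′ B} (h : F.F₀ C 𝒜.⇒ R.F₀ B) (f : C′ 𝒞.⇒ C) →
               Ψ (h 𝒜.∘ F.F₁ f) 𝒞.≈ Ψ h 𝒞.∘ f

  counit : ∀ B → F.F₀ (G.F₀ B) 𝒜.⇒ R.F₀ B
  counit B = Ψ⁻¹ (𝒞.id {G.F₀ B})

module Dupl {oa ℓa ea ob ℓb eb : Level}
            (𝒜 : Category oa ℓa ea) (ℬ : Category ob ℓb eb)
            (L : Functor ⌊ 𝒜 ⌋ ⌊ ℬ ⌋) (R : Functor ⌊ ℬ ⌋ ⌊ 𝒜 ⌋)
            (L⊣R : L ⊣ R) where
  private
    module 𝒜 = Category 𝒜
    module ℬ = Category ℬ
    module L = Functor L
    module R = Functor R

  open Adjunction L⊣R using (φ; φ⁻¹; unit; naturalʳ)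

  Object : Set (oa ⊔ ob)
  Object = 𝒜.Obj ⊎ ℬ.Obj

  infix 10 _⁺ _⁻

  _⁺ : Object → 𝒜.Obj
  inj₁ A ⁺ = A
  inj₂ B ⁺ = R.F₀ B

  _⁻ : Object → ℬ.Obj
  inj₁ A ⁻ = L.F₀ A
  inj₂ B ⁻ = B

  Morphism : Rel Object ℓa
  Morphism X Y = X ⁺ 𝒜.⇒ R.F₀ (Y ⁻)

  identity : ∀ X → Morphism X X
  identity (inj₁ A) = unit A
  identity (inj₂ B) = 𝒜.id

  compose : ∀ X Z Y → Morphism Z Y → Morphism X Z → Morphism X Y
  compose X (inj₁ A) Y g f = R.F₁ (φ⁻¹ g) 𝒜.∘ f
  compose X (inj₂ B) Y g f = g 𝒜.∘ f

  compose-cong : ∀ X Z Y {g g′ : Morphism Z Y} {f f′ : Morphism X Z} →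
                 g 𝒜.≈ g′ → f 𝒜.≈ f′ → compose X Z Y g f 𝒜.≈ compose X Z Y g′ f′
  compose-cong X (inj₁ A) Y p q =
    𝒜.∘-cong (R.F-cong (Inverse.from-cong (Adjunction.bijection L⊣R A (Y ⁻)) p)) q
  compose-cong X (inj₂ B) Y p q = 𝒜.∘-cong p q

  φ⁻¹-unit : ∀ A → φ⁻¹ (unit A) ℬ.≈ ℬ.id
  φ⁻¹-unit A = Inverse.strictlyInverseʳ (Adjunction.bijection L⊣R A (L.F₀ A)) ℬ.id

  R-φ⁻¹-unit : ∀ {A B} (f : A 𝒜.⇒ R.F₀ B) → R.F₁ (φ⁻¹ f) 𝒜.∘ unit A 𝒜.≈ f
  R-φ⁻¹-unit {A} {B} f = begin
    R.F₁ (φ⁻¹ f) 𝒜.∘ unit A  ≈⟨ naturalʳ (φ⁻¹ f) ℬ.id ⟨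
    φ (φ⁻¹ f ℬ.∘ ℬ.id)       ≈⟨ Inverse.to-cong bij ℬ.identityʳ ⟩
    φ (φ⁻¹ f)                ≈⟨ Inverse.strictlyInverseˡ bij f ⟩
    f                        ∎
    where
      bij = Adjunction.bijection L⊣R A B
      open SetoidReasoning (𝒜.hom A (R.F₀ B))

  compose-identityˡ : ∀ X Y (f : Morphism X Y) → compose X Y Y (identity Y) f 𝒜.≈ f
  compose-identityˡ X (inj₁ A) f = 𝒜.Equiv.trans
    (𝒜.∘-cong (𝒜.Equiv.trans (R.F-cong (φ⁻¹-unit A)) R.identity) 𝒜.Equiv.refl)
    𝒜.identityˡ
  compose-identityˡ X (inj₂ B) f = 𝒜.identityˡ

  compose-identityʳ : ∀ X Y (f : Morphism X Y) → compose X X Y f (identity X) 𝒜.≈ f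
  compose-identityʳ (inj₁ A) Y f = R-φ⁻¹-unit f
  compose-identityʳ (inj₂ B) Y f = 𝒜.identityʳ

  dupl : NonAssociativeCategory (oa ⊔ ob) ℓa ea
  dupl = record
    { Obj       = Object
    ; _⇒_       = Morphism
    ; _≈_       = 𝒜._≈_
    ; equiv     = 𝒜.equiv
    ; id        = λ {X} → identity X
    ; _∘_       = λ {X} {Z} {Y} → compose X Z Y
    ; ∘-cong    = λ {X} {Z} {Y} → compose-cong X Z Y
    ; identityˡ = λ {X} {Y} {f} → compose-identityˡ X Y f
    ; identityʳ = λ {X} {Y} {f} → compose-identityʳ X Y f
    }

  module Induced {oc ℓc ec : Level} (𝒞 : Category oc ℓc ec)
                 (F : Functor ⌊ 𝒞 ⌋ ⌊ 𝒜 ⌋) (G : Functor ⌊ ℬ ⌋ ⌊ 𝒞 ⌋)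
                 (coadj : RelativeCoadjunction 𝒜 ℬ 𝒞 R F G) where
    private
      module 𝒞 = Category 𝒞
      module F = Functor F
      module G = Functor G

    open RelativeCoadjunction coadj using (Ψ; counit)

    Fᵈ₁ : ∀ {C C′} → C 𝒞.⇒ C′ → Morphism (inj₁ (F.F₀ C)) (inj₁ (F.F₀ C′))
    Fᵈ₁ {C} {C′} f = unit (F.F₀ C′) 𝒜.∘ F.F₁ f

    Fᵈ₁-homomorphism : ∀ {C C′ C″} (g : C′ 𝒞.⇒ C″) (f : C 𝒞.⇒ C′) →
                       Fᵈ₁ (g 𝒞.∘ f) 𝒜.≈
                       compose (inj₁ (F.F₀ C)) (inj₁ (F.F₀ C′)) (inj₁ (F.F₀ C″))
                               (Fᵈ₁ g) (Fᵈ₁ f)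
    Fᵈ₁-homomorphism {C} {C′} {C″} g f = begin
      unit _ 𝒜.∘ F.F₁ (g 𝒞.∘ f)                        ≈⟨ 𝒜.∘-cong 𝒜.Equiv.refl F.homomorphism ⟩
      unit _ 𝒜.∘ (F.F₁ g 𝒜.∘ F.F₁ f)                   ≈⟨ 𝒜.assoc ⟨
      Fᵈ₁ g 𝒜.∘ F.F₁ f                                 ≈⟨ 𝒜.∘-cong (R-φ⁻¹-unit (Fᵈ₁ g)) 𝒜.Equiv.refl ⟨
      (R.F₁ (φ⁻¹ (Fᵈ₁ g)) 𝒜.∘ unit _) 𝒜.∘ F.F₁ f       ≈⟨ 𝒜.assoc ⟩
      R.F₁ (φ⁻¹ (Fᵈ₁ g)) 𝒜.∘ Fᵈ₁ f                     ∎
      where open SetoidReasoning (𝒜.hom (F.F₀ C) (R.F₀ (L.F₀ (F.F₀ C″))))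

    Fᵈ : Functor ⌊ 𝒞 ⌋ dupl
    Fᵈ = record
      { bareFunctor = record
        { F₀       = λ C → inj₁ (F.F₀ C)
        ; F₁       = Fᵈ₁
        ; F-cong   = λ p → 𝒜.∘-cong 𝒜.Equiv.refl (F.F-cong p)
        ; identity = 𝒜.Equiv.trans (𝒜.∘-cong 𝒜.Equiv.refl F.identity) 𝒜.identityʳ
        }
      ; homomorphism = λ {_} {_} {_} {g} {f} → Fᵈ₁-homomorphism g f
      }

    G⁻₁ : ∀ X Y → Morphism X Y → G.F₀ (X ⁻) 𝒞.⇒ G.F₀ (Y ⁻)
    G⁻₁ (inj₁ A) Y f = G.F₁ (φ⁻¹ f)
    G⁻₁ (inj₂ B) Y f = Ψ (f 𝒜.∘ counit B)

    G⁻₁-cong : ∀ X Y {f g : Morphism X Y} → f 𝒜.≈ g → G⁻₁ X Y f 𝒞.≈ G⁻₁ X Y g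
    G⁻₁-cong (inj₁ A) Y p =
      G.F-cong (Inverse.from-cong (Adjunction.bijection L⊣R A (Y ⁻)) p)
    G⁻₁-cong (inj₂ B) Y p =
      Inverse.to-cong (RelativeCoadjunction.bijection coadj (G.F₀ B) (Y ⁻))
                      (𝒜.∘-cong p 𝒜.Equiv.refl)

    G⁻₁-identity : ∀ X → G⁻₁ X X (identity X) 𝒞.≈ 𝒞.id
    G⁻₁-identity (inj₁ A) = 𝒞.Equiv.trans (G.F-cong (φ⁻¹-unit A)) G.identity
    G⁻₁-identity (inj₂ B) = 𝒞.Equiv.trans
      (Inverse.to-cong bij 𝒜.identityˡ) (Inverse.strictlyInverseˡ bij 𝒞.id)
      where bij = RelativeCoadjunction.bijection coadj (G.F₀ B) B

    G⁻ : BareFunctor dupl ⌊ 𝒞 ⌋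
    G⁻ = record
      { F₀       = λ X → G.F₀ (X ⁻)
      ; F₁       = λ {X} {Y} → G⁻₁ X Y
      ; F-cong   = λ {X} {Y} → G⁻₁-cong X Y
      ; identity = λ {X} → G⁻₁-identity X
      }

{-# OPTIONS --safe #-}

-- Maps FC → Y in the duploid are exactly maps FC → R(Y⁻) in 𝒜, so φ can be taken to be Ψ.
-- Precomposing with the image of f : C′ → C in the duploid amounts to precomposing with Ff
-- in 𝒜, so naturality in C is that of Ψ.  Naturality in Y is that of Ψ when the
-- source of the morphism is in 𝒜; when it is in ℬ, it follows by factoring h as ε ∘ F(Ψ h).
-- Every object of 𝒜 is positive, because postcomposition with h out of it is
-- postcomposition with R ĥ in 𝒜, and transposition is natural.
module Submission where

open import Defs

open import Data.Sum using (inj₁; inj₂)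
open import Function.Bundles using (Inverse)
import Relation.Binary.Reasoning.Setoid as SetoidReasoning

-- Naturality of `φ` in its target passes to its inverse: rewrite `h` as `φ (φ⁻¹ h)`, then cancel
-- `φ⁻¹` against `φ`. It is used to transpose composites of the form `R ĥ ∘ g`.
φ⁻¹-naturalʳ :
  ∀ {o ℓ e o′ ℓ′ e′}
    {𝒟 : NonAssociativeCategory o ℓ e} {ℰ : NonAssociativeCategory o′ ℓ′ e′}
    {F : BareFunctor 𝒟 ℰ} {G : BareFunctor ℰ 𝒟} (adj : Adjunction F G) →
    let module 𝒟 = NonAssociativeCategory 𝒟
        module ℰ = NonAssociativeCategory ℰ
        module F = BareFunctor F
        module G = BareFunctor G
        open Adjunction adj
    in ∀ {A B B′} (g : B ℰ.⇒ B′) (h : A 𝒟.⇒ G.F₀ B) →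
       φ⁻¹ (G.F₁ g 𝒟.∘ h) ℰ.≈ g ℰ.∘ φ⁻¹ h
φ⁻¹-naturalʳ {𝒟 = 𝒟} {ℰ} {F} {G} adj {A} {B} {B′} g h = begin
  φ⁻¹ (G.F₁ g 𝒟.∘ h)            ≈⟨ Inverse.from-cong (bijection A B′)
                                     (𝒟.∘-cong 𝒟.Equiv.refl (Inverse.strictlyInverseˡ (bijection A B) h)) ⟨
  φ⁻¹ (G.F₁ g 𝒟.∘ φ (φ⁻¹ h))    ≈⟨ Inverse.from-cong (bijection A B′) (naturalʳ g (φ⁻¹ h)) ⟨
  φ⁻¹ (φ (g ℰ.∘ φ⁻¹ h))         ≈⟨ Inverse.strictlyInverseʳ (bijection A B′) (g ℰ.∘ φ⁻¹ h) ⟩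
  g ℰ.∘ φ⁻¹ h                   ∎
  where
    module 𝒟 = NonAssociativeCategory 𝒟
    module ℰ = NonAssociativeCategory ℰ
    module F = BareFunctor F
    module G = BareFunctor G
    open Adjunction adj
    open SetoidReasoning (ℰ.hom (F.F₀ A) B′)

module _
  {oa ℓa ea ob ℓb eb oc ℓc ec}
  {𝒜 : Category oa ℓa ea} {ℬ : Category ob ℓb eb} {𝒞 : Category oc ℓc ec}
  {R : Functor ⌊ ℬ ⌋ ⌊ 𝒜 ⌋} {F : Functor ⌊ 𝒞 ⌋ ⌊ 𝒜 ⌋} {G : Functor ⌊ ℬ ⌋ ⌊ 𝒞 ⌋}
  (coadj : RelativeCoadjunction 𝒜 ℬ 𝒞 R F G) where

  private
    module 𝒜 = Category 𝒜
    module 𝒞 = Category 𝒞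
    module R = Functor R
    module F = Functor F

  open RelativeCoadjunction coadj

  -- `Ψ` is injective, and it sends both sides to `Ψ h`, by naturality in `C` and
  -- `Ψ (counit B) ≈ id`.
  counit-factor : ∀ {C B} (h : F.F₀ C 𝒜.⇒ R.F₀ B) → counit B 𝒜.∘ F.F₁ (Ψ h) 𝒜.≈ h
  counit-factor {C} {B} h = begin
    counit B 𝒜.∘ F.F₁ (Ψ h)              ≈⟨ Inverse.strictlyInverseʳ (bijection C B) _ ⟨
    Ψ⁻¹ (Ψ (counit B 𝒜.∘ F.F₁ (Ψ h)))    ≈⟨ Inverse.from-cong (bijection C B) Ψ-counit-factor ⟩
    Ψ⁻¹ (Ψ h)                            ≈⟨ Inverse.strictlyInverseʳ (bijection C B) h ⟩
    h                                    ∎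
    where
      Ψ-counit-factor : Ψ (counit B 𝒜.∘ F.F₁ (Ψ h)) 𝒞.≈ Ψ h
      Ψ-counit-factor = 𝒞.Equiv.trans (naturalˡ (counit B) (Ψ h)) (𝒞.Equiv.trans
        (𝒞.∘-cong (Inverse.strictlyInverseˡ (bijection _ B) 𝒞.id) 𝒞.Equiv.refl)
        𝒞.identityˡ)
      open SetoidReasoning (𝒜.hom (F.F₀ C) (R.F₀ B))

  -- Here `g` is an arbitrary map of `𝒜`, not necessarily of the form `R k`, so naturality in `B`
  -- does not apply. Factoring `h` through the counit leaves only naturality in `C` to use.
  Ψ-∘ : ∀ {C B B′} (g : R.F₀ B 𝒜.⇒ R.F₀ B′) (h : F.F₀ C 𝒜.⇒ R.F₀ B) →
        Ψ (g 𝒜.∘ h) 𝒞.≈ Ψ (g 𝒜.∘ counit B) 𝒞.∘ Ψ h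
  Ψ-∘ {C} {B} {B′} g h = 𝒞.Equiv.trans
    (Inverse.to-cong (bijection C B′) (begin
      g 𝒜.∘ h                              ≈⟨ 𝒜.∘-cong 𝒜.Equiv.refl (counit-factor h) ⟨
      g 𝒜.∘ (counit B 𝒜.∘ F.F₁ (Ψ h))      ≈⟨ 𝒜.assoc ⟨
      (g 𝒜.∘ counit B) 𝒜.∘ F.F₁ (Ψ h)      ∎))
    (naturalˡ (g 𝒜.∘ counit B) (Ψ h))
    where open SetoidReasoning (𝒜.hom (F.F₀ C) (R.F₀ B′))

module _
  {oa ℓa ea ob ℓb eb}
  (𝒜 : Category oa ℓa ea) (ℬ : Category ob ℓb eb)
  (L : Functor ⌊ 𝒜 ⌋ ⌊ ℬ ⌋) (R : Functor ⌊ ℬ ⌋ ⌊ 𝒜 ⌋) (L⊣R : L ⊣ R) where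

  private
    module 𝒜 = Category 𝒜
    module R = Functor R

  open Dupl 𝒜 ℬ L R L⊣R
  open Adjunction L⊣R using (φ⁻¹)

  inj₁-positive : ∀ A → NonAssociativeCategory.Positive dupl (inj₁ A)
  -- The left side transposes `R ĥ ∘ g`, which gives `ĥ ∘ ĝ`; functoriality of `R` then splits it.
  inj₁-positive A h {Y = inj₁ _} f g = 𝒜.Equiv.trans
    (𝒜.∘-cong (𝒜.Equiv.trans (R.F-cong (φ⁻¹-naturalʳ L⊣R (φ⁻¹ h) g)) R.homomorphism)
              𝒜.Equiv.refl)
    𝒜.assoc
  -- Composition at an object of `ℬ` is that of `𝒜`, so both sides bracket `R ĥ`, `g`, `f`.
  inj₁-positive A h {Y = inj₂ _} f g = 𝒜.assoc

  module _
    {oc ℓc ec} (𝒞 : Category oc ℓc ec)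
    (F : Functor ⌊ 𝒞 ⌋ ⌊ 𝒜 ⌋) (G : Functor ⌊ ℬ ⌋ ⌊ 𝒞 ⌋)
    (coadj : RelativeCoadjunction 𝒜 ℬ 𝒞 R F G) where

    private
      module 𝒞 = Category 𝒞
      module F = Functor F

    open Induced 𝒞 F G coadj
    open RelativeCoadjunction coadj

    -- The unit inside `Fᵈ₁ f` is absorbed by the transpose of `h`, since `R ĥ ∘ η ≈ h`.
    compose-Fᵈ₁ : ∀ {C C′} Y (h : Morphism (inj₁ (F.F₀ C)) Y) (f : C′ 𝒞.⇒ C) →
                  compose (inj₁ (F.F₀ C′)) (inj₁ (F.F₀ C)) Y h (Fᵈ₁ f) 𝒜.≈ h 𝒜.∘ F.F₁ f
    compose-Fᵈ₁ Y h f =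
      𝒜.Equiv.trans (𝒜.Equiv.sym 𝒜.assoc) (𝒜.∘-cong (R-φ⁻¹-unit h) 𝒜.Equiv.refl)

    Ψ-compose : ∀ {C} Z Y (g : Morphism Z Y) (h : Morphism (inj₁ (F.F₀ C)) Z) →
                Ψ (compose (inj₁ (F.F₀ C)) Z Y g h) 𝒞.≈ G⁻₁ Z Y g 𝒞.∘ Ψ h
    Ψ-compose (inj₁ _) Y g h = naturalʳ (φ⁻¹ g) h
    Ψ-compose (inj₂ _) Y g h = Ψ-∘ coadj g h

    Fᵈ⊣G⁻ : Adjunction (Functor.bareFunctor Fᵈ) G⁻
    Fᵈ⊣G⁻ = record
      { bijection = λ C Y → bijection C (Y ⁻)
      ; naturalʳ  = λ {_} {Z} {Y} g h → Ψ-compose Z Y g h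
      ; naturalˡ  = λ {C} {_} {Y} h f → 𝒞.Equiv.trans
          (Inverse.to-cong (bijection _ (Y ⁻)) (compose-Fᵈ₁ Y h f)) (naturalˡ h f)
      }

proposition33 :
  ∀ {oa ℓa ea ob ℓb eb oc ℓc ec}
    (𝒜 : Category oa ℓa ea) (ℬ : Category ob ℓb eb) (𝒞 : Category oc ℓc ec)
    (L : Functor ⌊ 𝒜 ⌋ ⌊ ℬ ⌋) (R : Functor ⌊ ℬ ⌋ ⌊ 𝒜 ⌋) (L⊣R : L ⊣ R)
    (F : Functor ⌊ 𝒞 ⌋ ⌊ 𝒜 ⌋) (G : Functor ⌊ ℬ ⌋ ⌊ 𝒞 ⌋)
    (coadj : RelativeCoadjunction 𝒜 ℬ 𝒞 R F G) →
    let open Dupl 𝒜 ℬ L R L⊣R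
        open Induced 𝒞 F G coadj
    in PositiveAdjunction (Functor.bareFunctor Fᵈ) G⁻
proposition33 𝒜 ℬ 𝒞 L R L⊣R F G coadj = record
  { adjunction = Fᵈ⊣G⁻ 𝒜 ℬ L R L⊣R 𝒞 F G coadj
  ; positive   = λ C → inj₁-positive 𝒜 ℬ L R L⊣R (Functor.F₀ F C)
  }
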